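{- Let $c\geq 1$ be an integer. For all integers $n\geq 1$, $$\bar a_c(n)\equiv\begin{cases}2 \pmod 4 & \text{if } n=k^2 \text{ for some } k\in\mathbb{Z},\\ 2(c+1)\pmod 4 & \text{if } n=2k^2 \text{ for some } k\in\mathbb{Z},\\ 0\pmod 4 & \text{otherwise.}\end{cases}$$
   Context: For an integer $k\geq 1$ let $f_k:=\prod_{n\geq 1}(1-q^{kn})$. For an integer $c\geq1$, the generalized overcubic partition function $\bar a_c(n)$ is defined by the generating function $\sum_{n\geq 0}\bar a_c(n)q^n=\dfrac{f_4^{c-1}}{f_1^2f_2^{2c-3}}$. -}

module Defs where

open import Data.Bool.Base using (if_then_else_)
open import Data.Fin.Base using (Fin; zero; suc; toℕ)
open import Data.Fin.Properties using (toℕ<n)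
open import Data.Integer.Base using (ℤ; +_; -[1+_]; 0ℤ; 1ℤ; _+_; _-_; -_; _*_)
open import Data.Integer.Divisibility using (_∣_)
open import Data.Integer.Properties
open import Data.Nat.Base as ℕ using (ℕ; zero; suc; _∸_; NonZero)
import Data.Nat.Properties as ℕ
open import Data.Vec.Base using (Vec; []; _∷_; head; lookup)
open import Relation.Nullary using (does)
open import Relation.Nullary.Decidable using (dec-false)
open import Relation.Binary.PropositionalEquality
open import Algebra.Properties.Semiring.Sum +-*-semiring
  using (sum; sum-cong-≗; sum-replicate-zero; sum⁺-syntax)

------------------------------------------------------------------------
-- Formal power series in q over ℤ, as coefficient sequences

Series : Set
Series = ℕ → ℤ

infixl 7 _⊛_ _⊘_
infixl 6 _⊖_
infixr 8 _^ˢ_ _^ᶻ_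

q^_ : ℕ → Series
(q^ m) n = if does (n ℕ.≟ m) then 1ℤ else 0ℤ

𝟙 : Series
𝟙 = q^ 0

_⊖_ : Series → Series → Series
(f ⊖ g) n = f n - g n

_⊛_ : Series → Series → Series
(f ⊛ g) n = ∑[ i ≤ n ] (f (toℕ i) * g (n ∸ toℕ i))

_^ˢ_ : Series → ℕ → Series
f ^ˢ zero  = 𝟙
f ^ˢ suc n = f ⊛ f ^ˢ n

-- Solving f ⊛ g = 𝟙 coefficient by coefficient when f 0 ≡ 1ℤ gives
--   g 0 = 1,   g (n + 1) = - ∑_{i ≤ n} f (i + 1) * g (n - i).
-- The vector holds g n , … , g 0, latest coefficient first.

inverse-prefix : Series → (n : ℕ) → Vec ℤ (suc n)
inverse-prefix f zero    = 1ℤ ∷ []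
inverse-prefix f (suc n) = - (∑[ i ≤ n ] (f (suc (toℕ i)) * lookup gs i)) ∷ gs
  where gs = inverse-prefix f n

-- Meaningful only for series with constant term 1; see ⊛-inverse.
_⁻¹ : Series → Series
(f ⁻¹) n = head (inverse-prefix f n)

_⊘_ : Series → Series → Series
f ⊘ g = f ⊛ g ⁻¹

_^ᶻ_ : Series → ℤ → Series
f ^ᶻ (+ n)    = f ^ˢ n
f ^ᶻ -[1+ n ] = (f ^ˢ suc n) ⁻¹

lookup-prefix : ∀ f n (i : Fin (suc n)) →
                lookup (inverse-prefix f n) i ≡ (f ⁻¹) (n ∸ toℕ i)
lookup-prefix f zero    zero    = refl
lookup-prefix f (suc n) zero    = refl
lookup-prefix f (suc n) (suc i) = lookup-prefix f n i

⊛-inverse : ∀ f → f 0 ≡ 1ℤ → ∀ n → (f ⊛ f ⁻¹) n ≡ 𝟙 n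
⊛-inverse f f₀ zero    rewrite f₀ = refl
⊛-inverse f f₀ (suc n) = begin
  f 0 * - S + T  ≡⟨ cong (λ x → x * - S + T) f₀ ⟩
  1ℤ * - S + T   ≡⟨ cong (_+ T) (*-identityˡ (- S)) ⟩
  - S + T        ≡⟨ cong (λ x → - S + x) (sum-cong-≗ {suc n} λ i →
                      cong (f (suc (toℕ i)) *_) (sym (lookup-prefix f n i))) ⟩
  - S + S        ≡⟨ +-inverseˡ S ⟩
  0ℤ             ∎
  where
  open ≡-Reasoning
  S = ∑[ i ≤ n ] (f (suc (toℕ i)) * lookup (inverse-prefix f n) i)
  T = ∑[ i ≤ n ] (f (suc (toℕ i)) * (f ⁻¹) (n ∸ toℕ i))

------------------------------------------------------------------------
-- f k = ∏_{n ≥ 1} (1 - q^{kn})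

-- ∏_{n = 1}^{N} (1 - q^{kn})
partial : ℕ → ℕ → Series
partial k zero    = 𝟙
partial k (suc N) = (𝟙 ⊖ q^ (k ℕ.* suc N)) ⊛ partial k N

-- For k ≥ 1 the factors with index greater than n do not affect the
-- coefficient of q^n (partial-stable), so that coefficient of the infinite
-- product is the one of its first n factors.
f : (k : ℕ) .{{_ : NonZero k}} → Series
f k n = partial k n n

⊛-high : ∀ {m n} → n ℕ.< m → ∀ g → ((𝟙 ⊖ q^ m) ⊛ g) n ≡ g n
⊛-high {suc m} {n} n<m g = begin
  1ℤ * g n + ∑⁺ n      ≡⟨ cong₂ _+_ (*-identityˡ (g n)) (vanish n n<m) ⟩
  g n + 0ℤ             ≡⟨ +-identityʳ (g n) ⟩
  g n                  ∎
  where
  open ≡-Reasoning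
  term : (n : ℕ) → Fin n → ℤ
  term n i = (𝟙 ⊖ q^ suc m) (suc (toℕ i)) * g (n ∸ suc (toℕ i))
  ∑⁺ : ℕ → ℤ
  ∑⁺ n = sum (term n)
  vanish : ∀ n → n ℕ.< suc m → ∑⁺ n ≡ 0ℤ
  vanish n n<m = trans (sum-cong-≗ zero-term) (sum-replicate-zero n)
    where
    zero-term : ∀ i → term n i ≡ 0ℤ
    zero-term i
      rewrite dec-false (suc (toℕ i) ℕ.≟ suc m)
                (ℕ.<⇒≢ (ℕ.≤-<-trans (toℕ<n i) n<m)) = refl

partial-stable : ∀ k .{{_ : NonZero k}} n d → partial k (d ℕ.+ n) n ≡ f k n
partial-stable k n zero    = refl
partial-stable k n (suc d) = trans
  (⊛-high (ℕ.≤-trans (ℕ.s≤s (ℕ.m≤n+m n d)) (ℕ.m≤n*m (suc (d ℕ.+ n)) k))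
          (partial k (d ℕ.+ n)))
  (partial-stable k n d)

------------------------------------------------------------------------
-- The generalized overcubic partition function ā_c

-- The exponents c - 1 and 2c - 3 are integers: for c = 1 the latter is -1.
ā : ℕ → ℕ → ℤ
ā c = f 4 ^ᶻ (+ c - + 1) ⊘ (f 1 ^ᶻ (+ 2) ⊛ f 2 ^ᶻ (+ 2 * + c - + 3))

------------------------------------------------------------------------
-- Congruence of integers

infix 4 _≡_[mod_]

_≡_[mod_] : ℤ → ℤ → ℤ → Set
a ≡ b [mod m ] = m ∣ (a - b)

{-# OPTIONS --safe #-}

-- Write θ(q) = f₁²/f₂, so that the generating function is
-- 1 / (θ(q) θ(q²)^(c-1)).  Modulo 4 one has
-- (1-x)² = (1-x²)(1 + 2x/(1-x)), and (1+2A)(1+2B) = 1 + 2(A+B); taking the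
-- product over x = q^(ki) gives f_k² = f_2k (1 + 2 ∑_{i,j≥1} q^(kij)).  The
-- double sum is symmetric in i and j, so only its diagonal ∑_{i≥1} q^(ki²)
-- survives the factor 2.  As (1+2A)² = 1, the generating function is
-- 1 + 2 ∑ q^(i²) + 2(c-1) ∑ q^(2i²) modulo 4, and no positive integer is both
-- a square and twice a square.

module Submission where

open import Algebra.Bundles using (CommutativeRing)
import Algebra.Properties.CommutativeSemiring.Exp as Exp
import Algebra.Properties.Semiring.Mult as Mult
import Algebra.Solver.Ring.NaturalCoefficients.Default as Solver
open import Data.Nat.Base as ℕ using (ℕ; zero; suc; z≤n; s≤s; z<s; s<s; NonZero; _≥_)

-- Finite sums and the geometric series in a commutative ring

module FiniteSums {c ℓ} (R : CommutativeRing c ℓ) where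
  open CommutativeRing R
  open Solver commutativeSemiring
  open import Relation.Binary.Reasoning.Setoid setoid

  ∑< : ℕ → (ℕ → Carrier) → Carrier
  ∑< zero    a = 0#
  ∑< (suc n) a = a n + ∑< n a

  ∑<-+ : ∀ n a b → ∑< n (λ i → a i + b i) ≈ ∑< n a + ∑< n b
  ∑<-+ zero a b = sym (+-identityˡ 0#)
  ∑<-+ (suc n) a b = trans (+-congˡ (∑<-+ n a b))
    (solve 4 (λ x y z w → x :+ y :+ (z :+ w) := x :+ z :+ (y :+ w)) refl (a n) (b n) (∑< n a) (∑< n b))

  ∑<-cong : ∀ n {a b} → (∀ i → a i ≈ b i) → ∑< n a ≈ ∑< n b
  ∑<-cong zero p = refl
  ∑<-cong (suc n) p = +-cong (p n) (∑<-cong n p)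

  -- The sum telescopes, since e y_j = y_j - y_(j+1). Writing e + x ≈ 1 instead of e = 1 - x keeps
  -- the algebra within reach of the semiring solver. The remainder y_n is kept, to be removed later
  -- by truncation.
  geometric : ∀ {e x} {y : ℕ → Carrier} → e + x ≈ 1# → (∀ j → y (suc j) ≈ x * y j) →
              ∀ n → e * ∑< n y + y n ≈ y 0
  geometric {e} {x} {y} e+x≈1 step zero = trans (+-congʳ (zeroʳ e)) (+-identityˡ (y 0))
  geometric {e} {x} {y} e+x≈1 step (suc n) = begin
    e * (y n + ∑< n y) + y (suc n)  ≈⟨ +-congˡ (step n) ⟩
    e * (y n + ∑< n y) + x * y n    ≈⟨ solve 4 (λ e x y s → e :* (y :+ s) :+ x :* y := e :* s :+ (e :+ x) :* y) refl e x (y n) (∑< n y) ⟩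
    e * ∑< n y + (e + x) * y n      ≈⟨ +-congˡ (trans (*-congʳ e+x≈1) (*-identityˡ (y n))) ⟩
    e * ∑< n y + y n                ≈⟨ geometric e+x≈1 step n ⟩
    y 0                             ∎

-- Calculations in a ring where 4 = 0

FourIsZero : ∀ {c ℓ} → CommutativeRing c ℓ → Set ℓ
FourIsZero R = 1# + 1# + 1# + 1# ≈ 0#
  where open CommutativeRing R

module CharacteristicFour {c ℓ} (R : CommutativeRing c ℓ) (4≈0 : FourIsZero R) where
  open CommutativeRing R
  open Exp commutativeSemiring
  open Mult semiring
  open FiniteSums R
  open Solver commutativeSemiring
  open import Relation.Binary.Reasoning.Setoid setoid

  2# 4# : Carrier
  2# = 1# + 1#
  4# = 1# + 1# + 1# + 1#

  drop-4 : ∀ x y → x + 4# * y ≈ x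
  drop-4 x y = begin
    x + 4# * y  ≈⟨ +-congˡ (*-congʳ 4≈0) ⟩
    x + 0# * y  ≈⟨ +-congˡ (zeroˡ y) ⟩
    x + 0#      ≈⟨ +-identityʳ x ⟩
    x           ∎

  1+2_ : Carrier → Carrier
  1+2 a = 1# + (a + a)

  -- Only the doubles are compared, because a symmetric double sum agrees with its diagonal only
  -- after doubling.
  1+2-cong : ∀ {a b} → a + a ≈ b + b → 1+2 a ≈ 1+2 b
  1+2-cong = +-congˡ

  -- The cross term 4ab vanishes, so products of such factors become sums.
  1+2-homo : ∀ a b → 1+2 a * 1+2 b ≈ 1+2 (a + b)
  1+2-homo a b = trans
    (solve 2 (λ a b → (con 1 :+ (a :+ a)) :* (con 1 :+ (b :+ b)) :=
                      con 1 :+ ((a :+ b) :+ (a :+ b)) :+ con 4 :* (a :* b)) refl a b)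
    (drop-4 (1+2 (a + b)) (a * b))

  -- Such a factor is its own inverse, which lets it pass from the denominator to the numerator of
  -- the generating function.
  1+2-involutive : ∀ a → 1+2 a * 1+2 a ≈ 1#
  1+2-involutive a = trans
    (solve 1 (λ a → (con 1 :+ (a :+ a)) :* (con 1 :+ (a :+ a)) :=
                      con 1 :+ con 4 :* (a :+ a :* a)) refl a)
    (drop-4 1# (a + a * a))

  1+2-^ : ∀ a n → (1+2 a) ^ n ≈ 1+2 (n × a)
  1+2-^ a zero = solve 0 (con 1 := con 1 :+ (con 0 :+ con 0)) refl
  1+2-^ a (suc n) = trans (*-congˡ (1+2-^ a n)) (1+2-homo a (n × a))

  -- Enlarging the square array by one row and one column adds the corner d and two arms, equal by
  -- symmetry to B each. After doubling, the arms contribute 4B = 0.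
  ∑<-symmetric : ∀ (a : ℕ → ℕ → Carrier) → (∀ i j → a i j ≈ a j i) → ∀ n →
    let T = ∑< n (λ i → ∑< n (a i)) ; D = ∑< n (λ i → a i i) in T + T ≈ D + D
  ∑<-symmetric a a-sym zero = refl
  ∑<-symmetric a a-sym (suc n) = begin
    T′ + T′                                ≈⟨ +-cong T′≈ T′≈ ⟩
    (d + B + (B + T)) + (d + B + (B + T))  ≈⟨ solve 3 (λ d B T → (d :+ B :+ (B :+ T)) :+ (d :+ B :+ (B :+ T)) := (T :+ T) :+ (d :+ d) :+ con 4 :* B) refl d B T ⟩
    (T + T) + (d + d) + 4# * B             ≈⟨ drop-4 ((T + T) + (d + d)) B ⟩
    (T + T) + (d + d)                      ≈⟨ +-congʳ (∑<-symmetric a a-sym n) ⟩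
    (D + D) + (d + d)                      ≈⟨ solve 2 (λ D d → (D :+ D) :+ (d :+ d) := (d :+ D) :+ (d :+ D)) refl D d ⟩
    (d + D) + (d + D)                      ∎
    where
    T = ∑< n (λ i → ∑< n (a i))
    D = ∑< n (λ i → a i i)
    B = ∑< n (a n)
    d = a n n
    T′ = ∑< (suc n) (λ i → ∑< (suc n) (a i))
    T′≈ : T′ ≈ d + B + (B + T)
    T′≈ = +-congˡ (trans (∑<-+ n (λ i → a i n) (λ i → ∑< n (a i)))
                         (+-congʳ (∑<-cong n (λ i → a-sym i n))))

  -- Here g stands for x/(1-x), given by its defining equation so that no division occurs. With e =
  -- 1 - x one has 1 - x² = e(e + 2x), and replacing eg by x leaves e² + 4(ex + x²).
  square-of-1-x : ∀ x g → (1# - x) * g ≈ x →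
                  (1# - x) * (1# - x) ≈ (1# - x * x) * 1+2 g
  square-of-1-x x g eg≈x = sym (begin
    (1# - x * x) * 1+2 g                                ≈⟨ *-congʳ 1-xx ⟩
    e * (e + (x + x)) * 1+2 g                           ≈⟨ solve 3 (λ e x g → e :* (e :+ (x :+ x)) :* (con 1 :+ (g :+ g)) := (e :* (e :+ (x :+ x)) :+ con 2 :* ((e :+ (x :+ x)) :* (e :* g)))) refl e x g ⟩
    e * (e + (x + x)) + 2# * ((e + (x + x)) * (e * g))  ≈⟨ +-congˡ (*-congˡ (*-congˡ eg≈x)) ⟩
    e * (e + (x + x)) + 2# * ((e + (x + x)) * x)        ≈⟨ solve 2 (λ e x → e :* (e :+ (x :+ x)) :+ con 2 :* ((e :+ (x :+ x)) :* x) := e :* e :+ con 4 :* (e :* x :+ x :* x)) refl e x ⟩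
    e * e + 4# * (e * x + x * x)                        ≈⟨ drop-4 (e * e) (e * x + x * x) ⟩
    e * e                                               ∎)
    where
    e = 1# - x
    e+x : e + x ≈ 1#
    e+x = trans (+-assoc 1# (- x) x) (trans (+-congˡ (-‿inverseˡ x)) (+-identityʳ 1#))
    1-xx : 1# - x * x ≈ e * (e + (x + x))
    1-xx = begin
      1# - x * x                         ≈⟨ +-congʳ (trans (*-cong e+x e+x) (*-identityˡ 1#)) ⟨
      (e + x) * (e + x) - x * x          ≈⟨ +-congʳ (solve 2 (λ e x → (e :+ x) :* (e :+ x) := e :* (e :+ (x :+ x)) :+ x :* x) refl e x) ⟩
      e * (e + (x + x)) + x * x - x * x  ≈⟨ trans (+-assoc _ _ _) (trans (+-congˡ (-‿inverseʳ _)) (+-identityʳ _)) ⟩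
      e * (e + (x + x))                  ∎

  -- Used with aₖ = f_k, E = f₂^(2n-1) and n = c - 1; the goal is the generating function.
  quotient-formula : ∀ n {a₁ a₂ a₄ t₁ t₂ E I} →
    a₁ * a₁ ≈ a₂ * 1+2 t₁ → a₂ * a₂ ≈ a₄ * 1+2 t₂ →
    a₂ * E ≈ (a₂ * a₂) ^ n → (a₁ * a₁ * E) * I ≈ 1# →
    a₄ ^ n * I ≈ 1+2 (t₁ + n × t₂)
  quotient-formula n {a₁} {a₂} {a₄} {t₁} {t₂} {E} {I} sq₁ sq₂ a₂E DI = begin
    a₄ ^ n * I               ≈⟨ *-congʳ a₄≈ ⟩
    w * (a₁ * a₁ * E) * I    ≈⟨ *-assoc w _ I ⟩
    w * ((a₁ * a₁ * E) * I)  ≈⟨ trans (*-congˡ DI) (*-identityʳ w) ⟩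
    w                        ∎
    where
    w = 1+2 (t₁ + n × t₂)
    D≈ : a₁ * a₁ * E ≈ w * a₄ ^ n
    D≈ = begin
      a₁ * a₁ * E                       ≈⟨ *-congʳ sq₁ ⟩
      a₂ * 1+2 t₁ * E                   ≈⟨ solve 3 (λ a u E → a :* u :* E := u :* (a :* E)) refl a₂ (1+2 t₁) E ⟩
      1+2 t₁ * (a₂ * E)                 ≈⟨ *-congˡ (trans a₂E (^-congˡ n sq₂)) ⟩
      1+2 t₁ * (a₄ * 1+2 t₂) ^ n        ≈⟨ *-congˡ (trans (^-distrib-* a₄ (1+2 t₂) n) (*-congˡ (1+2-^ t₂ n))) ⟩
      1+2 t₁ * (a₄ ^ n * 1+2 (n × t₂))  ≈⟨ solve 3 (λ u a v → u :* (a :* v) := u :* v :* a) refl (1+2 t₁) (a₄ ^ n) (1+2 (n × t₂)) ⟩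
      1+2 t₁ * 1+2 (n × t₂) * a₄ ^ n    ≈⟨ *-congʳ (1+2-homo t₁ (n × t₂)) ⟩
      w * a₄ ^ n                        ∎
    a₄≈ : a₄ ^ n ≈ w * (a₁ * a₁ * E)
    a₄≈ = sym (begin
      w * (a₁ * a₁ * E)  ≈⟨ *-congˡ D≈ ⟩
      w * (w * a₄ ^ n)   ≈⟨ *-assoc w w _ ⟨
      w * w * a₄ ^ n     ≈⟨ *-congʳ (1+2-involutive _) ⟩
      1# * a₄ ^ n        ≈⟨ *-identityˡ _ ⟩
      a₄ ^ n             ∎)

open import Algebra.Structures using (IsCommutativeRing)
open import Data.Integer.Base using (ℤ; +_; -[1+_]; 0ℤ; 1ℤ; _+_; _-_; -_; _*_; _^_; ∣_∣)
import Data.Integer.Divisibility.Signed as ℤ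
import Data.Integer.Properties as ℤ
open import Data.Integer.Tactic.RingSolver using (solve-∀)
import Data.Nat.Divisibility as ℕ
open import Data.Nat.Induction using (<-rec)
open import Data.Nat.Primality using (euclidsLemma; prime[2])
import Data.Nat.Properties as ℕ
import Data.Nat.Tactic.RingSolver as ℕ using (solve-∀)
open import Data.Product.Base using (_×_; _,_; Σ-syntax; ∃-syntax)
open import Data.Sum.Base using (inj₁; inj₂; reduce)
open import Defs
open import Function.Base using (_∘_)
open import Level using (0ℓ)
open import Relation.Binary.PropositionalEquality
open import Relation.Nullary using (¬_; contradiction)
open import Relation.Nullary.Decidable using (dec-true; dec-false)

-- Ring laws for the Cauchy product

tail : Series → Series
tail F = F ∘ suc

_⊕_ : Series → Series → Series
(F ⊕ G) n = F n + G n

_⊙_ : ℤ → Series → Series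
(a ⊙ F) n = a * F n

-- The coefficient at n involves only coefficients of index at most n. This makes the product
-- compatible with truncation.
⊛-cong : ∀ {ℓ} (_~_ : ℤ → ℤ → Set ℓ) →
         (∀ {a b} → a ≡ b → a ~ b) →
         (∀ {a b c d} → a ~ b → c ~ d → (a + c) ~ (b + d)) →
         (∀ {a b c d} → a ~ b → c ~ d → (a * c) ~ (b * d)) →
         ∀ {F F′ G G′} n → (∀ i → i ℕ.≤ n → F i ~ F′ i) → (∀ i → i ℕ.≤ n → G i ~ G′ i) →
         (F ⊛ G) n ~ (F′ ⊛ G′) n
⊛-cong _~_ rfl add mul zero F~F′ G~G′ =
  add (mul (F~F′ 0 z≤n) (G~G′ 0 z≤n)) (rfl refl)
⊛-cong _~_ rfl add mul (suc n) F~F′ G~G′ =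
  add (mul (F~F′ 0 z≤n) (G~G′ (suc n) ℕ.≤-refl))
      (⊛-cong _~_ rfl add mul n
        (λ i i≤n → F~F′ (suc i) (s≤s i≤n)) (λ i i≤n → G~G′ i (ℕ.m≤n⇒m≤1+n i≤n)))

-- By definition `(F ⊛ G) (suc n)` unfolds to `F 0 * G (suc n) + (tail F ⊛ G) n`; the ring laws are
-- inductions on the index along this recursion.
⊛-distribʳ : ∀ H F G n → ((F ⊕ G) ⊛ H) n ≡ (F ⊛ H) n + (G ⊛ H) n
⊛-distribʳ H F G zero = alg (F 0) (G 0) (H 0)
  where
  alg : ∀ a b c → (a + b) * c + 0ℤ ≡ (a * c + 0ℤ) + (b * c + 0ℤ)
  alg = solve-∀
⊛-distribʳ H F G (suc n) = trans
  (cong (_+_ ((F 0 + G 0) * H (suc n))) (⊛-distribʳ H (tail F) (tail G) n))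
  (alg (F 0) (G 0) (H (suc n)) ((tail F ⊛ H) n) ((tail G ⊛ H) n))
  where
  alg : ∀ a b c x y → (a + b) * c + (x + y) ≡ (a * c + x) + (b * c + y)
  alg = solve-∀

⊙-⊛ : ∀ a F G n → ((a ⊙ F) ⊛ G) n ≡ a * (F ⊛ G) n
⊙-⊛ a F G zero = alg a (F 0) (G 0)
  where
  alg : ∀ a b c → a * b * c + 0ℤ ≡ a * (b * c + 0ℤ)
  alg = solve-∀
⊙-⊛ a F G (suc n) = trans
  (cong (_+_ (a * F 0 * G (suc n))) (⊙-⊛ a (tail F) G n))
  (alg a (F 0) (G (suc n)) ((tail F ⊛ G) n))
  where
  alg : ∀ a b c x → a * b * c + a * x ≡ a * (b * c + x)
  alg = solve-∀

⊛-assoc : ∀ F G H n → ((F ⊛ G) ⊛ H) n ≡ (F ⊛ (G ⊛ H)) n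
⊛-assoc F G H zero = alg (F 0) (G 0) (H 0)
  where
  alg : ∀ a b c → (a * b + 0ℤ) * c + 0ℤ ≡ a * (b * c + 0ℤ) + 0ℤ
  alg = solve-∀
⊛-assoc F G H (suc n) = begin
  (a * b + 0ℤ) * h + (tail (F ⊛ G) ⊛ H) n
    -- `tail (F ⊛ G)` is definitionally `(a ⊙ tail G) ⊕ (tail F ⊛ G)`.
    ≡⟨ cong (_+_ ((a * b + 0ℤ) * h)) (⊛-distribʳ H (a ⊙ tail G) (tail F ⊛ G) n) ⟩
  (a * b + 0ℤ) * h + (((a ⊙ tail G) ⊛ H) n + ((tail F ⊛ G) ⊛ H) n)
    ≡⟨ cong₂ (λ x y → (a * b + 0ℤ) * h + (x + y)) (⊙-⊛ a (tail G) H n) (⊛-assoc (tail F) G H n) ⟩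
  (a * b + 0ℤ) * h + (a * (tail G ⊛ H) n + (tail F ⊛ (G ⊛ H)) n)
    ≡⟨ alg a b h ((tail G ⊛ H) n) ((tail F ⊛ (G ⊛ H)) n) ⟩
  a * (b * h + (tail G ⊛ H) n) + (tail F ⊛ (G ⊛ H)) n
    ∎
  where
  open ≡-Reasoning
  a = F 0
  b = G 0
  h = H (suc n)
  alg : ∀ a b c x y → (a * b + 0ℤ) * c + (a * x + y) ≡ a * (b * c + x) + y
  alg = solve-∀

-- Splits off the last term of the convolution, whereas unfolding splits off the first.
-- Commutativity exchanges the two.
⊛-suc : ∀ F G n → (F ⊛ G) (suc n) ≡ F (suc n) * G 0 + (F ⊛ tail G) n
⊛-suc F G zero = alg (F 0) (F 1) (G 0) (G 1)
  where
  alg : ∀ a b c d → a * d + (b * c + 0ℤ) ≡ b * c + (a * d + 0ℤ)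
  alg = solve-∀
⊛-suc F G (suc n) = trans
  (cong (_+_ (F 0 * G (suc (suc n)))) (⊛-suc (tail F) G n))
  (alg (F 0 * G (suc (suc n))) (F (suc (suc n)) * G 0) ((tail F ⊛ tail G) n))
  where
  alg : ∀ x y z → x + (y + z) ≡ y + (x + z)
  alg = solve-∀

⊛-comm : ∀ F G n → (F ⊛ G) n ≡ (G ⊛ F) n
⊛-comm F G zero = cong (_+ 0ℤ) (ℤ.*-comm (F 0) (G 0))
⊛-comm F G (suc n) = trans (⊛-suc F G n)
  (cong₂ _+_ (ℤ.*-comm (F (suc n)) (G 0)) (⊛-comm F (tail G) n))

⊛-zeroˡ : ∀ G n → ((λ _ → 0ℤ) ⊛ G) n ≡ 0ℤ
⊛-zeroˡ G zero = refl
⊛-zeroˡ G (suc n) = trans (ℤ.+-identityˡ (((λ _ → 0ℤ) ⊛ G) n)) (⊛-zeroˡ G n)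

⊛-identityˡ : ∀ G n → (𝟙 ⊛ G) n ≡ G n
⊛-identityˡ G zero = trans (ℤ.+-identityʳ (1ℤ * G 0)) (ℤ.*-identityˡ (G 0))
⊛-identityˡ G (suc n) = trans
  (cong₂ _+_ (ℤ.*-identityˡ (G (suc n))) (⊛-zeroˡ G n)) (ℤ.+-identityʳ (G (suc n)))

q^-+ : ∀ m l n → (q^ m ⊛ q^ l) n ≡ (q^ (m ℕ.+ l)) n
q^-+ zero l n = ⊛-identityˡ (q^ l) n
q^-+ (suc m) l zero = refl
q^-+ (suc m) l (suc n) = trans (ℤ.+-identityˡ ((q^ m ⊛ q^ l) n)) (q^-+ m l n)

-- The ring ℤ[q] / (m , q^(N+1)).
module Truncated (m : ℤ) (N : ℕ) where

  infix 4 _∼_ _≈_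

  -- A record rather than a synonym, so that a and b can be inferred from a ∼ b.
  record _∼_ (a b : ℤ) : Set where
    constructor mod
    field difference : m ℤ.∣ (a - b)

  ∼-reflexive : ∀ {a b} → a ≡ b → a ∼ b
  ∼-reflexive {a} refl = mod (ℤ.divides 0ℤ (ℤ.+-inverseʳ a))

  ∼-sym : ∀ {a b} → a ∼ b → b ∼ a
  ∼-sym {a} {b} (mod p) = mod (subst (m ℤ.∣_) (alg a b) (ℤ.∣m⇒∣-m p))
    where
    alg : ∀ a b → - (a - b) ≡ b - a
    alg = solve-∀

  ∼-trans : ∀ {a b c} → a ∼ b → b ∼ c → a ∼ c
  ∼-trans {a} {b} {c} (mod p) (mod q) = mod (subst (m ℤ.∣_) (alg a b c) (ℤ.∣m∣n⇒∣m+n p q))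
    where
    alg : ∀ a b c → (a - b) + (b - c) ≡ a - c
    alg = solve-∀

  ∼-+ : ∀ {a b c d} → a ∼ b → c ∼ d → a + c ∼ b + d
  ∼-+ {a} {b} {c} {d} (mod p) (mod q) = mod (subst (m ℤ.∣_) (alg a b c d) (ℤ.∣m∣n⇒∣m+n p q))
    where
    alg : ∀ a b c d → (a - b) + (c - d) ≡ (a + c) - (b + d)
    alg = solve-∀

  ∼-* : ∀ {a b c d} → a ∼ b → c ∼ d → a * c ∼ b * d
  ∼-* {a} {b} {c} {d} (mod p) (mod q) = mod (subst (m ℤ.∣_) (alg a b c d)
    (ℤ.∣m∣n⇒∣m+n (ℤ.∣m⇒∣m*n c p) (ℤ.∣n⇒∣m*n b q)))
    where
    alg : ∀ a b c d → (a - b) * c + b * (c - d) ≡ a * c - b * d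
    alg = solve-∀

  ∼-neg : ∀ {a b} → a ∼ b → - a ∼ - b
  ∼-neg {a} {b} (mod p) = mod (subst (m ℤ.∣_) (alg a b) (ℤ.∣m⇒∣-m p))
    where
    alg : ∀ a b → - (a - b) ≡ - a - - b
    alg = solve-∀

  _≈_ : Series → Series → Set
  F ≈ G = ∀ n → n ℕ.≤ N → F n ∼ G n

  ≗⇒≈ : ∀ {F G} → F ≗ G → F ≈ G
  ≗⇒≈ F≗G n _ = ∼-reflexive (F≗G n)

  ⊛-isCommutativeRing : IsCommutativeRing _≈_ _⊕_ _⊛_ (λ F n → - F n) (λ _ → 0ℤ) 𝟙
  ⊛-isCommutativeRing = record
    { isRing = record
      { +-isAbelianGroup = record
        { isGroup = record
          { isMonoid = record
            { isSemigroup = record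
              { isMagma = record
                { isEquivalence = record
                  { refl  = λ _ _ → ∼-reflexive refl
                  ; sym   = λ p n n≤N → ∼-sym (p n n≤N)
                  ; trans = λ p q n n≤N → ∼-trans (p n n≤N) (q n n≤N)
                  }
                ; ∙-cong = λ p q n n≤N → ∼-+ (p n n≤N) (q n n≤N)
                }
              ; assoc = λ F G H → ≗⇒≈ λ n → ℤ.+-assoc (F n) (G n) (H n)
              }
            ; identity = (λ F → ≗⇒≈ λ n → ℤ.+-identityˡ (F n))
                       , (λ F → ≗⇒≈ λ n → ℤ.+-identityʳ (F n))
            }
          ; inverse = (λ F → ≗⇒≈ λ n → ℤ.+-inverseˡ (F n))
                    , (λ F → ≗⇒≈ λ n → ℤ.+-inverseʳ (F n))
          ; ⁻¹-cong = λ p n n≤N → ∼-neg (p n n≤N)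
          }
        ; comm = λ F G → ≗⇒≈ λ n → ℤ.+-comm (F n) (G n)
        }
      ; *-cong = λ {F} {F′} {G} {G′} p q n n≤N → ⊛-cong _∼_ ∼-reflexive ∼-+ ∼-* {F} {F′} {G} {G′} n
          (λ i i≤n → p i (ℕ.≤-trans i≤n n≤N)) (λ i i≤n → q i (ℕ.≤-trans i≤n n≤N))
      ; *-assoc = λ F G H → ≗⇒≈ (⊛-assoc F G H)
      ; *-identity = (λ F → ≗⇒≈ (⊛-identityˡ F))
                   , (λ F → ≗⇒≈ λ n → trans (⊛-comm F 𝟙 n) (⊛-identityˡ F n))
      ; distrib = (λ F G H → ≗⇒≈ λ n → trans (⊛-comm F (G ⊕ H) n)
                    (trans (⊛-distribʳ F G H n)
                      (cong₂ _+_ (⊛-comm G F n) (⊛-comm H F n))))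
                , (λ H F G → ≗⇒≈ (⊛-distribʳ H F G))
      }
    ; *-comm = λ F G → ≗⇒≈ (⊛-comm F G)
    }

  ring : CommutativeRing 0ℓ 0ℓ
  ring = record { isCommutativeRing = ⊛-isCommutativeRing }

-- Monomial coefficients, constant terms and the exponent 2c - 3

q^-same : ∀ m → (q^ m) m ≡ 1ℤ
q^-same m rewrite dec-true (m ℕ.≟ m) refl = refl

q^-other : ∀ {m n} → n ≢ m → (q^ m) n ≡ 0ℤ
q^-other {m} {n} n≢m rewrite dec-false (n ℕ.≟ m) n≢m = refl

⊛-const : ∀ {F G} → F 0 ≡ 1ℤ → G 0 ≡ 1ℤ → (F ⊛ G) 0 ≡ 1ℤ
⊛-const F₀ G₀ = cong₂ (λ a b → a * b + 0ℤ) F₀ G₀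

^ˢ-const : ∀ {F} → F 0 ≡ 1ℤ → ∀ n → (F ^ˢ n) 0 ≡ 1ℤ
^ˢ-const F₀ zero = refl
^ˢ-const {F} F₀ (suc n) = ⊛-const {F} {F ^ˢ n} F₀ (^ˢ-const F₀ n)

^ᶻ-const : ∀ {F} → F 0 ≡ 1ℤ → ∀ z → (F ^ᶻ z) 0 ≡ 1ℤ
^ᶻ-const F₀ (+ n)    = ^ˢ-const F₀ n
-- Every `⁻¹` starts with 1 by construction.
^ᶻ-const F₀ -[1+ n ] = refl

-- For c = m + 2 the exponent is a natural number, written so that one more factor completes two
-- halves of size m + 1.
2c-3 : ∀ m → + 2 * + suc (suc m) - + 3 ≡ + (m ℕ.+ suc m)
2c-3 m = alg (+ m)
  where
  alg : ∀ x → + 2 * (+ 2 + x) - + 3 ≡ x + (+ 1 + x)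
  alg = solve-∀

-- Squares of Euler products modulo 4

module Mod4 (N : ℕ) where

  open Truncated (+ 4) N using (mod; ∼-reflexive; ≗⇒≈)

  R : CommutativeRing 0ℓ 0ℓ
  R = Truncated.ring (+ 4) N

  module R = CommutativeRing R

  4≈0 : FourIsZero R
  4≈0 n _ = mod (ℤ.divides (𝟙 n) (alg (𝟙 n)))
    where
    alg : ∀ a → a + a + a + a - 0ℤ ≡ a * + 4
    alg = solve-∀

  open R using (_≈_)
  open FiniteSums R
  open CharacteristicFour R 4≈0
  open Exp R.commutativeSemiring using (^-distrib-*; ^-homo-*) renaming (_^_ to _^ᴿ_)
  open Mult R.semiring using () renaming (_×_ to _×ᴿ_)
  open Solver R.commutativeSemiring using (solve; _:*_; _:=_)
  open import Relation.Binary.Reasoning.Setoid R.setoid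

  -- Each coefficient of `f k` comes from a partial product of its own length; up to degree N the
  -- length N serves them all.
  f≈partial : ∀ k .{{_ : NonZero k}} → f k ≈ partial k N
  f≈partial k n n≤N = ∼-reflexive (sym
    (subst (λ M → partial k M n ≡ f k n) (ℕ.m∸n+n≡m n≤N) (partial-stable k n (N ℕ.∸ n))))

  module _ (k : ℕ) .{{_ : NonZero k}} where

    -- The indices are shifted by one, so that the sum over i, j ≥ 1 starts at 0.
    term : ℕ → ℕ → Series
    term i j = q^ (k ℕ.* (suc i ℕ.* suc j))

    ratio : ℕ → Series
    ratio i = q^ (k ℕ.* suc i)

    term-step : ∀ i j → term i (suc j) ≈ ratio i ⊛ term i j
    term-step i j = ≗⇒≈ λ n → sym (trans (q^-+ (k ℕ.* suc i) (k ℕ.* (suc i ℕ.* suc j)) n)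
      (cong (λ l → (q^ l) n) (alg k i j)))
      where
      alg : ∀ k i j → k ℕ.* suc i ℕ.+ k ℕ.* (suc i ℕ.* suc j) ≡ k ℕ.* (suc i ℕ.* suc (suc j))
      alg = ℕ.solve-∀

    -- The exponent exceeds N, so the remainder of the geometric sum vanishes in the truncated ring.
    term-top : ∀ i → term i N ≈ R.0#
    term-top i n n≤N = ∼-reflexive (q^-other (ℕ.<⇒≢ (ℕ.≤-<-trans n≤N
      (ℕ.≤-trans (ℕ.m≤n*m (suc N) (suc i)) (ℕ.m≤n*m (suc i ℕ.* suc N) k)))))

    row : ℕ → Series
    row i = ∑< N (term i)

    -- Up to degree N, `row i` is x/(1-x) for x = `ratio i`, as `square-of-1-x` requires.
    row-sum : ∀ i → (R.1# R.- ratio i) ⊛ row i ≈ ratio i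
    row-sum i = begin
      e ⊛ row i               ≈⟨ R.+-identityʳ (e ⊛ row i) ⟨
      (e ⊛ row i) ⊕ R.0#      ≈⟨ R.+-congˡ {e ⊛ row i} (R.sym (term-top i)) ⟩
      (e ⊛ row i) ⊕ term i N  ≈⟨ geometric {e} {ratio i} {term i} e+ratio≈1 (term-step i) N ⟩
      term i 0                ≈⟨ ≗⇒≈ (λ n → cong (λ l → (q^ (k ℕ.* l)) n) (ℕ.*-identityʳ (suc i))) ⟩
      ratio i                 ∎
      where
      e = R.1# R.- ratio i
      e+ratio≈1 : e ⊕ ratio i ≈ R.1#
      e+ratio≈1 = ≗⇒≈ λ n → alg (𝟙 n) (ratio i n)
        where
        alg : ∀ a b → a - b + b ≡ a
        alg = solve-∀

    -- Each factor is squared by `square-of-1-x`, and `1+2-homo` gathers the corrections. The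
    -- induction is on the number M of factors, while the row length stays N.
    partial-square : ∀ M → partial k M ⊛ partial k M ≈ partial (2 ℕ.* k) M ⊛ 1+2 (∑< M row)
    partial-square zero = R.*-congˡ {𝟙} (≗⇒≈ λ n → sym (ℤ.+-identityʳ (𝟙 n)))
    partial-square (suc M) = begin
      (e ⊛ P) ⊛ (e ⊛ P)
        ≈⟨ solve 2 (λ e P → (e :* P) :* (e :* P) := (e :* e) :* (P :* P)) R.refl e P ⟩
      (e ⊛ e) ⊛ (P ⊛ P)
        ≈⟨ R.*-cong (square-of-1-x (ratio M) (row M) (row-sum M)) (partial-square M) ⟩
      (R.1# R.- ratio M ⊛ ratio M) ⊛ u ⊛ (Q ⊛ U)
        ≈⟨ R.*-congʳ {Q ⊛ U} (R.*-congʳ {u} (R.+-congˡ {R.1#} (R.-‿cong ratio²))) ⟩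
      e₂ ⊛ u ⊛ (Q ⊛ U)
        ≈⟨ solve 4 (λ e u Q U → e :* u :* (Q :* U) := (e :* Q) :* (u :* U)) R.refl e₂ u Q U ⟩
      (e₂ ⊛ Q) ⊛ (u ⊛ U)
        ≈⟨ R.*-congˡ {e₂ ⊛ Q} (1+2-homo (row M) (∑< M row)) ⟩
      (e₂ ⊛ Q) ⊛ 1+2 (∑< (suc M) row) ∎
      where
      e = R.1# R.- ratio M
      P = partial k M
      Q = partial (2 ℕ.* k) M
      u = 1+2 (row M)
      U = 1+2 (∑< M row)
      e₂ = R.1# R.- q^ (2 ℕ.* k ℕ.* suc M)
      ratio² : ratio M ⊛ ratio M ≈ q^ (2 ℕ.* k ℕ.* suc M)
      ratio² = ≗⇒≈ λ n → trans (q^-+ (k ℕ.* suc M) (k ℕ.* suc M) n) (cong (λ l → (q^ l) n) (alg k M))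
        where
        alg : ∀ k M → k ℕ.* suc M ℕ.+ k ℕ.* suc M ≡ 2 ℕ.* k ℕ.* suc M
        alg = ℕ.solve-∀

    diagonal : Series
    diagonal = ∑< N (λ i → term i i)

    term-sym : ∀ i j → term i j ≈ term j i
    term-sym i j = ≗⇒≈ λ n → cong (λ l → (q^ (k ℕ.* l)) n) (ℕ.*-comm (suc i) (suc j))

    f-square : .{{_ : NonZero (2 ℕ.* k)}} → f k ⊛ f k ≈ f (2 ℕ.* k) ⊛ 1+2 diagonal
    f-square = begin
      f k ⊛ f k                  ≈⟨ R.*-cong (f≈partial k) (f≈partial k) ⟩
      partial k N ⊛ partial k N  ≈⟨ partial-square N ⟩
      partial (2 ℕ.* k) N ⊛ 1+2 (∑< N row)
        -- With M = N the array of terms is square, so its doubled sum reduces to the diagonal.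
        ≈⟨ R.*-cong (R.sym (f≈partial (2 ℕ.* k))) (1+2-cong {∑< N row} {diagonal} (∑<-symmetric term term-sym N)) ⟩
      f (2 ℕ.* k) ⊛ 1+2 diagonal ∎

    diagonal-none : ∀ M n → (∀ i → i ℕ.< M → n ≢ k ℕ.* (suc i ℕ.* suc i)) → ∑< M (λ i → term i i) n ≡ 0ℤ
    diagonal-none zero n none = refl
    diagonal-none (suc M) n none = cong₂ _+_ (q^-other (none M ℕ.≤-refl))
      (diagonal-none M n (λ i i<M → none i (ℕ.m<n⇒m<1+n i<M)))

    -- The exponents k(i+1)² increase strictly with i, so no other diagonal term meets this one.
    diagonal-one : ∀ M i → i ℕ.< M → ∑< M (λ i → term i i) (k ℕ.* (suc i ℕ.* suc i)) ≡ 1ℤ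
    diagonal-one (suc M) i i<1+M with ℕ.m<1+n⇒m<n∨m≡n i<1+M
    ... | inj₁ i<M  = cong₂ _+_ (q^-other (ℕ.<⇒≢ (grow i<M))) (diagonal-one M i i<M)
      where
      grow : ∀ {i j} → i ℕ.< j → k ℕ.* (suc i ℕ.* suc i) ℕ.< k ℕ.* (suc j ℕ.* suc j)
      grow i<j = ℕ.*-monoʳ-< k (ℕ.*-mono-< (s<s i<j) (s<s i<j))
    ... | inj₂ refl = cong₂ _+_ (q^-same (k ℕ.* (suc i ℕ.* suc i)))
      (diagonal-none i _ (λ j j<i → ℕ.>⇒≢ (ℕ.*-monoʳ-< k (ℕ.*-mono-< (s<s j<i) (s<s j<i)))))

  -- The generating function modulo 4

  ^ˢ≡^ : ∀ F n → F ^ˢ n ≡ F ^ᴿ n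
  ^ˢ≡^ F zero = refl
  ^ˢ≡^ F (suc n) = cong (F ⊛_) (^ˢ≡^ F n)

  -- The exponent 2(c+1) - 3 = 2c - 1 is negative at c = 0; one extra factor f₂ raises it to 2c,
  -- which is natural for every c.
  f₂-power : ∀ c → f 2 ⊛ (f 2 ^ᶻ (+ 2 * + suc c - + 3)) ≈ (f 2 ⊛ f 2) ^ᴿ c
  f₂-power zero = begin
    f 2 ⊛ (f 2 ^ˢ 1) ⁻¹         ≈⟨ R.*-congʳ {(f 2 ^ˢ 1) ⁻¹} (R.sym (R.*-identityʳ (f 2))) ⟩
    (f 2 ^ˢ 1) ⊛ (f 2 ^ˢ 1) ⁻¹  ≈⟨ ≗⇒≈ (⊛-inverse (f 2 ^ˢ 1) refl) ⟩
    𝟙                           ∎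
  f₂-power (suc m) rewrite 2c-3 m | ^ˢ≡^ (f 2) (m ℕ.+ suc m) = begin
    f 2 ^ᴿ (suc m ℕ.+ suc m)         ≈⟨ ^-homo-* (f 2) (suc m) (suc m) ⟩
    (f 2 ^ᴿ suc m) ⊛ (f 2 ^ᴿ suc m)  ≈⟨ ^-distrib-* (f 2) (f 2) (suc m) ⟨
    (f 2 ⊛ f 2) ^ᴿ suc m             ∎

  ā-mod-4 : ∀ c → ā (suc c) ≈ 1+2 (diagonal 1 ⊕ (c ×ᴿ diagonal 2))
  ā-mod-4 c = begin
    (f 4 ^ˢ c) ⊛ I                        ≡⟨ cong (_⊛ I) (^ˢ≡^ (f 4) c) ⟩
    (f 4 ^ᴿ c) ⊛ I                        ≈⟨ quotient-formula c {f 1} {f 2} {f 4} {diagonal 1} {diagonal 2} {E} {I} (f-square 1) (f-square 2) (f₂-power c) S⊛I≈𝟙 ⟩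
    1+2 (diagonal 1 ⊕ (c ×ᴿ diagonal 2))  ∎
    where
    E = f 2 ^ᶻ (+ 2 * + suc c - + 3)
    S = (f 1 ^ˢ 2) ⊛ E
    I = S ⁻¹
    S⊛I≈𝟙 : (f 1 ⊛ f 1 ⊛ E) ⊛ I ≈ 𝟙
    S⊛I≈𝟙 = begin
      (f 1 ⊛ f 1 ⊛ E) ⊛ I  ≈⟨ R.*-congʳ {I} (R.*-congʳ {E} (R.*-congˡ {f 1} (R.sym (R.*-identityʳ (f 1))))) ⟩
      -- `⊛-inverse` needs constant term 1, which S inherits from f₁ and f₂.
      S ⊛ I                ≈⟨ ≗⇒≈ (⊛-inverse S (⊛-const {f 1 ^ˢ 2} {E} refl (^ᶻ-const {f 2} refl (+ 2 * + suc c - + 3)))) ⟩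
      𝟙                    ∎

  ×-coeff : ∀ c F n → (c ×ᴿ F) n ≡ + c * F n
  ×-coeff zero F n = refl
  ×-coeff (suc c) F n = trans (cong (_+_ (F n)) (×-coeff c F n)) (sym (ℤ.suc-* (+ c) (F n)))

-- Irrationality of √2 by descent

√2-descent : ∀ a b → a ℕ.* a ≡ 2 ℕ.* (b ℕ.* b) → ∃[ h ] a ≡ h ℕ.* 2 × b ℕ.* b ≡ 2 ℕ.* (h ℕ.* h)
√2-descent a b eq with reduce (euclidsLemma a a prime[2] (ℕ.divides (b ℕ.* b) (trans eq (ℕ.*-comm 2 (b ℕ.* b)))))
... | ℕ.divides h refl = h , refl , ℕ.*-cancelˡ-≡ (b ℕ.* b) (2 ℕ.* (h ℕ.* h)) 2 (trans (sym eq) (alg h))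
  where
  alg : ∀ h → h ℕ.* 2 ℕ.* (h ℕ.* 2) ≡ 2 ℕ.* (2 ℕ.* (h ℕ.* h))
  alg = ℕ.solve-∀

√2-irrational : ∀ a b → a ℕ.* a ≡ 2 ℕ.* (b ℕ.* b) → a ≡ 0
√2-irrational = <-rec _ descend
  where
  h<h*2 : ∀ h → h ≢ 0 → h ℕ.< h ℕ.* 2
  h<h*2 zero h≢0 = contradiction refl h≢0
  h<h*2 (suc h) _ = ℕ.m<m*n (suc h) 2 (s<s z<s)
  descend : ∀ a → (∀ {h} → h ℕ.< a → ∀ b → h ℕ.* h ≡ 2 ℕ.* (b ℕ.* b) → h ≡ 0) →
            ∀ b → a ℕ.* a ≡ 2 ℕ.* (b ℕ.* b) → a ≡ 0
  descend zero    rec b eq = refl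
  descend (suc a) rec b eq with √2-descent (suc a) b eq
  -- One descent leads from (a, b) to (b, h), a second to (h, l). As a = 2h is positive, h < a and
  -- the recursion applies.
  ... | h , a≡ , eq₁ with √2-descent b h eq₁
  ... | l , b≡ , eq₂ = trans a≡ (cong (ℕ._* 2)
    (rec (subst (h ℕ.<_) (sym a≡) (h<h*2 h (λ {refl → contradiction a≡ λ ()}))) l eq₂))

-- Numbers of the form kz² and the coefficient of q^n

Rep : ℕ → ℕ → Set
Rep k n = ∃[ i ] n ≡ k ℕ.* (suc i ℕ.* suc i)

∣z^2∣ : ∀ z → ∣ z ^ 2 ∣ ≡ ∣ z ∣ ℕ.* ∣ z ∣
∣z^2∣ z = trans (cong (λ w → ∣ z * w ∣) (ℤ.*-identityʳ z)) (ℤ.abs-* z z)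

-- Absolute values remove the sign of z, and n ≥ 1 excludes z = 0; the root then has the shifted
-- form i + 1 used by the diagonal terms.
toRep : ∀ k {n} z → n ≥ 1 → + n ≡ + k * z ^ 2 → Rep k n
toRep k {n} z n≥1 eq = positive ∣ z ∣
  (trans (cong ∣_∣ eq) (trans (ℤ.abs-* (+ k) (z ^ 2)) (cong (k ℕ.*_) (∣z^2∣ z))))
  where
  positive : ∀ a → n ≡ k ℕ.* (a ℕ.* a) → Rep k n
  positive zero    n≡ = contradiction (trans n≡ (ℕ.*-zeroʳ k)) (ℕ.>⇒≢ n≥1)
  positive (suc i) n≡ = i , n≡

fromRep : ∀ k {n} → Rep k n → Σ[ z ∈ ℤ ] + n ≡ + k * z ^ 2
fromRep k (i , refl) = + suc i , trans (ℤ.pos-* k (suc i ℕ.* suc i))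
  (cong (λ w → + k * (+ suc i * w)) (sym (ℤ.*-identityʳ (+ suc i))))

module _ (k n : ℕ) .{{_ : NonZero k}} where

  diagonal-rep : Rep k n → Mod4.diagonal n k n ≡ 1ℤ
  diagonal-rep (i , refl) = Mod4.diagonal-one n k n i
    -- The truncation degree is n itself, and i + 1 ≤ k(i+1)² = n puts i in range.
    (ℕ.≤-trans (ℕ.m≤m*n (suc i) (suc i)) (ℕ.m≤n*m (suc i ℕ.* suc i) k))

  diagonal-nonrep : ¬ Rep k n → Mod4.diagonal n k n ≡ 0ℤ
  diagonal-nonrep ¬rep = Mod4.diagonal-none n k n n (λ i _ n≡ → ¬rep (i , n≡))

¬square∧twice-square : ∀ n → Rep 1 n → ¬ Rep 2 n
¬square∧twice-square n (i , n≡) (j , n≡′) with √2-irrational (suc i) (suc j)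
  (trans (sym (ℕ.*-identityˡ (suc i ℕ.* suc i))) (trans (sym n≡) n≡′))
... | ()

-- Reduces each case of the theorem to an integer identity in c, with t the quotient by 4.
ā-coefficient : ∀ c n {d₁ d₂} → n ≥ 1 →
                Mod4.diagonal n 1 n ≡ d₁ → Mod4.diagonal n 2 n ≡ d₂ →
                ∀ a t → + 2 * (d₁ + + c * d₂) - a ≡ t * + 4 →
                ā (suc c) n ≡ a [mod + 4 ]
-- Matching n as a successor makes the constant series contribute 0.
ā-coefficient c n@(suc _) n≥1 refl refl a t eq = ℤ.∣⇒∣ᵤ (difference (
  ∼-trans (ā-mod-4 c n ℕ.≤-refl)
    (∼-trans (∼-reflexive evaluate) (mod (ℤ.divides t eq)))))
  where
  open Mod4 n
  open Truncated (+ 4) n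
  open _∼_
  d₁ = diagonal 1 n
  d₂ = diagonal 2 n
  alg : ∀ x → 0ℤ + (x + x) ≡ + 2 * x
  alg = solve-∀
  evaluate = trans
    (cong (λ d → 0ℤ + ((d₁ + d) + (d₁ + d))) (×-coeff c (diagonal 2) n))
    (alg (d₁ + + c * d₂))

theorem1p3 : (c : ℕ) → c ≥ 1 → (n : ℕ) → n ≥ 1 →
    ((Σ[ k ∈ ℤ ] + n ≡ k ^ 2) → ā c n ≡ + 2 [mod + 4 ])
    × ((Σ[ k ∈ ℤ ] + n ≡ + 2 * k ^ 2) → ā c n ≡ + 2 * (+ c + + 1) [mod + 4 ])
    × (¬ (Σ[ k ∈ ℤ ] + n ≡ k ^ 2) → ¬ (Σ[ k ∈ ℤ ] + n ≡ + 2 * k ^ 2) → ā c n ≡ + 0 [mod + 4 ])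
theorem1p3 (suc c) _ n n≥1 = square , twice-square , neither
  where
  toRep₁ : Σ[ k ∈ ℤ ] + n ≡ k ^ 2 → Rep 1 n
  toRep₁ (k , eq) = toRep 1 k n≥1 (trans eq (sym (ℤ.*-identityˡ (k ^ 2))))

  toRep₂ : Σ[ k ∈ ℤ ] + n ≡ + 2 * k ^ 2 → Rep 2 n
  toRep₂ (k , eq) = toRep 2 k n≥1 eq

  fromRep₁ : Rep 1 n → Σ[ k ∈ ℤ ] + n ≡ k ^ 2
  fromRep₁ rep with k , eq ← fromRep 1 rep = k , trans eq (ℤ.*-identityˡ (k ^ 2))

  square : (Σ[ k ∈ ℤ ] + n ≡ k ^ 2) → ā (suc c) n ≡ + 2 [mod + 4 ]
  square sq = ā-coefficient c n n≥1 (diagonal-rep 1 n (toRep₁ sq)) (diagonal-nonrep 2 n (¬square∧twice-square n (toRep₁ sq)))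
    (+ 2) 0ℤ (alg (+ c))
    where
    alg : ∀ x → + 2 * (1ℤ + x * 0ℤ) - + 2 ≡ 0ℤ * + 4
    alg = solve-∀

  twice-square : (Σ[ k ∈ ℤ ] + n ≡ + 2 * k ^ 2) → ā (suc c) n ≡ + 2 * (+ suc c + + 1) [mod + 4 ]
  twice-square sq = ā-coefficient c n n≥1 (diagonal-nonrep 1 n (λ rep → ¬square∧twice-square n rep (toRep₂ sq))) (diagonal-rep 2 n (toRep₂ sq))
    -- The c of the theorem is `suc c` here: 2c - 2(c + 2) = -4, hence the quotient -1.
    (+ 2 * (+ suc c + + 1)) -[1+ 0 ] (alg (+ c))
    where
    alg : ∀ x → + 2 * (0ℤ + x * 1ℤ) - + 2 * (+ 1 + x + + 1) ≡ -[1+ 0 ] * + 4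
    alg = solve-∀

  neither : ¬ (Σ[ k ∈ ℤ ] + n ≡ k ^ 2) → ¬ (Σ[ k ∈ ℤ ] + n ≡ + 2 * k ^ 2) → ā (suc c) n ≡ + 0 [mod + 4 ]
  neither ¬sq ¬2sq = ā-coefficient c n n≥1 (diagonal-nonrep 1 n (¬sq ∘ fromRep₁)) (diagonal-nonrep 2 n (¬2sq ∘ fromRep 2))
    (+ 0) 0ℤ (alg (+ c))
    where
    alg : ∀ x → + 2 * (0ℤ + x * 0ℤ) - + 0 ≡ 0ℤ * + 4
    alg = solve-∀
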